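{- Let $\mathbf{w}\in\mathcal{K}_{m+}\setminus\{\mathbf{0}\}\subset\mathbb{R}^n$, $\varepsilon>0$, and $\mathbf{g}\in\mathbb{R}^n$. For $i=1,\dots,n$ let $\tau_i=\bigl(\sum_{j=1}^i w_j\bigr)^{ -1}$ and let $\mathbf{b}^{(i)}\in\mathbb{R}^n$ be the vector whose first $i$ entries equal $\tau_i$ and whose remaining entries equal $0$; let $\mathcal{B}=\{\mathbf{b}^{(1)},\dots,\mathbf{b}^{(n)}\}$. If $\hat{\mathbf{b}}\in\arg\max_{\mathbf{b}\in\mathcal{B}}\mathbf{b}^T|\mathbf{g}|_{\downarrow}$, then $$\mathbf{s}=\varepsilon\;\mathrm{sign}(\mathbf{g})\odot\bigl(\mathbf{P}(|\mathbf{g}|)^T\,\hat{\mathbf{b}}\bigr)$$ is a solution of the linear problem $\max\{\mathbf{s}^T\mathbf{g}:\ \mathbf{s}\in\mathbb{R}^n,\ \Omega_{\mathbf{w}}(\mathbf{s})\le\varepsilon\}$.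
   Context: $\mathcal{K}_{m+}=\{\mathbf{x}\in\mathbb{R}^n: x_1\ge x_2\ge\cdots\ge x_n\ge 0\}$ is the monotone non-negative cone. For $\mathbf{x}\in\mathbb{R}^n$, $|\mathbf{x}|$ is the vector of absolute values of its components, $|\mathbf{x}|_{\downarrow}$ is that vector sorted in non-increasing order, and $\mathbf{P}(|\mathbf{x}|)$ is a permutation matrix (ties broken arbitrarily) such that $|\mathbf{x}|_{\downarrow}=\mathbf{P}(|\mathbf{x}|)\,|\mathbf{x}|$. The ordered weighted $\ell_1$ (OWL) norm is $\Omega_{\mathbf{w}}(\mathbf{x})=\mathbf{w}^T|\mathbf{x}|_{\downarrow}$. $\mathrm{sign}$ is applied component-wise and $\odot$ is the entry-wise product. -}

module Defs where

open import Algebra.Bundles using (CommutativeRing)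
open import Algebra.Core using (Op₁; Op₂)
open import Algebra.Structures using (IsCommutativeRing)
import Algebra.Properties.Semiring.Sum as SemiringSum
open import Data.Bool.Base using (if_then_else_)
open import Data.Fin.Base as Fin using (Fin; toℕ; inject≤)
open import Data.Fin.Permutation using (Permutation′; _⟨$⟩ʳ_)
import Data.Fin.Properties as Fin
import Data.List.Base as List
import Data.List.Properties as List
open import Data.List.Relation.Binary.Permutation.Propositional.Properties using (↭-length)
import Data.List.Sort as Sort
open import Data.Nat.Base using (ℕ; suc)
open import Data.Product.Base using (∃; _×_)
open import Data.Vec.Functional using (Vector; map; zipWith; replicate)
import Data.Vec.Functional.Relation.Binary.Equality.Setoid as VectorEquality
open import Level using (_⊔_) renaming (suc to lsuc)
open import Relation.Binary.Bundles using (DecTotalOrder)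
open import Relation.Binary.Core using (Rel)
import Relation.Binary.Construct.Flip.EqAndOrd as Flip
import Relation.Binary.Construct.NonStrictToStrict as NonStrictToStrict
open import Relation.Binary.PropositionalEquality.Core as ≡ using (_≡_)
open import Relation.Binary.Structures using (IsDecTotalOrder)
open import Relation.Nullary.Decidable.Core using (does)
open import Relation.Nullary.Negation.Core using (¬_)
open import Relation.Unary using (Pred; Satisfiable; _∈_)

-- The real numbers, given axiomatically as a Dedekind-complete ordered
-- field.  The order is decidable, as it is in classical mathematics.
record RealNumbers c ℓ₁ ℓ₂ : Set (lsuc (c ⊔ ℓ₁ ⊔ ℓ₂)) where
  infix  8 -_
  infix  9 _⁻¹
  infixl 7 _*_
  infixl 6 _+_
  infix  4 _≈_ _≉_ _≤_
  field
    Carrier           : Set c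
    _≈_               : Rel Carrier ℓ₁
    _≤_               : Rel Carrier ℓ₂
    _+_ _*_           : Op₂ Carrier
    -_ _⁻¹            : Op₁ Carrier
    0# 1#             : Carrier
    isCommutativeRing : IsCommutativeRing _≈_ _+_ _*_ -_ 0# 1#
    isDecTotalOrder   : IsDecTotalOrder _≈_ _≤_

  _≉_ : Rel Carrier ℓ₁
  x ≉ y = ¬ (x ≈ y)

  open NonStrictToStrict _≈_ _≤_ public using (_<_)

  IsUpperBound : Pred Carrier (c ⊔ ℓ₁ ⊔ ℓ₂) → Pred Carrier (c ⊔ ℓ₁ ⊔ ℓ₂)
  IsUpperBound S u = ∀ x → x ∈ S → x ≤ u

  field
    0≉1         : 0# ≉ 1#
    -- The value of 0# ⁻¹ is left unspecified.
    ⁻¹-cong     : ∀ {x y} → x ≈ y → x ⁻¹ ≈ y ⁻¹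
    ⁻¹-inverseʳ : ∀ x → x ≉ 0# → x * x ⁻¹ ≈ 1#
    +-monoˡ-≤   : ∀ z {x y} → x ≤ y → x + z ≤ y + z
    *-nonNeg    : ∀ {x y} → 0# ≤ x → 0# ≤ y → 0# ≤ x * y
    supremum    : ∀ S → Satisfiable S → Satisfiable (IsUpperBound S) →
                  ∃ λ u → u ∈ IsUpperBound S × (∀ v → v ∈ IsUpperBound S → u ≤ v)

  commutativeRing : CommutativeRing c ℓ₁
  commutativeRing = record { isCommutativeRing = isCommutativeRing }

  decTotalOrder : DecTotalOrder c ℓ₁ ℓ₂
  decTotalOrder = record { isDecTotalOrder = isDecTotalOrder }

module OWL {c ℓ₁ ℓ₂} (ℝ : RealNumbers c ℓ₁ ℓ₂) where

  open RealNumbers ℝ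
  open IsDecTotalOrder isDecTotalOrder using (_≟_; _≤?_)
  open CommutativeRing commutativeRing using (semiring; setoid)
  open SemiringSum semiring using (sum)
  open VectorEquality setoid using (_≋_)
  open Sort (Flip.decTotalOrder decTotalOrder) using (sort; sort-↭)

  infixl 7 _⊙_ _·_ _*ᵥ_
  infixr 7 _•_
  infix  8 _↓

  private
    variable
      m n : ℕ

  Vec : ℕ → Set c
  Vec = Vector Carrier

  Matrix : ℕ → ℕ → Set c
  Matrix m n = Vector (Vec n) m

  𝟎 : Vec n
  𝟎 = replicate _ 0#

  _•_ : Carrier → Vec n → Vec n
  a • x = map (a *_) x

  _⊙_ : Vec n → Vec n → Vec n
  _⊙_ = zipWith _*_

  _·_ : Vec n → Vec n → Carrier
  x · y = sum (x ⊙ y)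

  _*ᵥ_ : Matrix m n → Vec n → Vec m
  A *ᵥ x = map (_· x) A

  ∣_∣ : Vec n → Vec n
  ∣_∣ = map λ a → if does (0# ≤? a) then a else - a

  sign : Vec n → Vec n
  sign = map λ a → if does (a ≟ 0#) then 0# else (if does (0# ≤? a) then 1# else - 1#)

  private
    length-sort : (x : Vec n) → n ≡ List.length (sort (List.tabulate x))
    length-sort x = ≡.sym (≡.trans (↭-length (sort-↭ (List.tabulate x))) (List.length-tabulate x))

  -- `sort` is taken over the flipped order, so x ↓ is non-increasing.
  _↓ : Vec n → Vec n
  (x ↓) i = List.lookup (sort (List.tabulate x)) (Fin.cast (length-sort x) i)

  IsPermutationMatrix : Matrix n n → Set ℓ₁
  IsPermutationMatrix {n} P = ∃ λ (π : Permutation′ n) →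
    ∀ i j → P i j ≈ (if does (π ⟨$⟩ʳ i Fin.≟ j) then 1# else 0#)

  IsSortingMatrix : Matrix n n → Vec n → Set ℓ₁
  IsSortingMatrix P x = IsPermutationMatrix P × x ↓ ≋ P *ᵥ x

  -- The cone 𝒦ₘ₊.
  MonotoneNonNegative : Pred (Vec n) ℓ₂
  MonotoneNonNegative x = (∀ i j → i Fin.≤ j → x j ≤ x i) × (∀ i → 0# ≤ x i)

  Ω : Vec n → Vec n → Carrier
  Ω w x = w · (∣ x ∣ ↓)

  -- Indices count from 0, so index i stands for i + 1 in the one-based
  -- notation: τ w i inverts the sum of the first toℕ i + 1 weights, and
  -- b w i has toℕ i + 1 leading entries equal to τ w i.
  τ : Vec n → Fin n → Carrier
  τ w i = sum {suc (toℕ i)} (λ j → w (inject≤ j (Fin.toℕ<n i))) ⁻¹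

  b : Vec n → Fin n → Vec n
  b w i k = if does (k Fin.≤? i) then τ w i else 0#

  𝓑 : Vec n → Pred (Vec n) ℓ₁
  𝓑 w x = ∃ λ i → x ≋ b w i

  ArgMax : ∀ {ℓ} → Pred (Vec n) ℓ → (Vec n → Carrier) → Pred (Vec n) (c ⊔ ℓ₂ ⊔ ℓ)
  ArgMax S f x = x ∈ S × (∀ y → y ∈ S → f y ≤ f x)

-- Let M be the maximum of b · |g|↓ over 𝓑.  The vector s attains the value
-- ε M, because sign (gⱼ) gⱼ = |gⱼ|; it is feasible, because the rearrangement
-- inequality bounds Ω w s by ε (w · b̂) = ε.  Conversely, b⁽ⁱ⁾ · |g|↓ ≤ M says
-- that the i-th prefix sum of |g|↓ is at most that of M w.  Abel summation
-- against the non-increasing |y|↓ turns this into |y|↓ · |g|↓ ≤ M (Ω w y), and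
-- the left-hand side is at least y · g, again by rearrangement.
module Submission where

open import Defs
open import Algebra.Bundles using (CommutativeRing)
import Algebra.Properties.AbelianGroup as AbelianGroupProperties
import Algebra.Properties.Ring as RingProperties
import Algebra.Properties.Semiring.Sum as SemiringSum
import Algebra.Solver.Ring.NaturalCoefficients.Default as SemiringSolver
open import Data.Bool.Base using (if_then_else_; true; false)
open import Data.Fin.Base as Fin using (Fin; zero; suc; toℕ; inject≤; punchIn)
open import Data.Fin.Permutation as Perm using (Permutation′; _⟨$⟩ʳ_; _⟨$⟩ˡ_; _∘ₚ_)
import Data.Fin.Properties as Fin
import Data.List.Base as List
import Data.List.Properties as List
import Data.List.Relation.Binary.Permutation.Homogeneous as Permutation
import Data.List.Relation.Binary.Permutation.Propositional as Permutation
open import Data.List.Relation.Binary.Permutation.Propositional.Properties using (↭-length)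
import Data.List.Relation.Binary.Permutation.Setoid.Properties as Permutation
import Data.List.Relation.Unary.Sorted.TotalOrder.Properties as Sorted
import Data.List.Sort as Sort
open import Data.Nat.Base as ℕ using (ℕ; suc; z≤n; s≤s)
import Data.Nat.Properties as ℕ
open import Data.Product.Base using (∃; _×_; _,_; proj₁; proj₂)
open import Data.Sum.Base using (inj₁; inj₂)
open import Data.Vec.Functional using (head; tail; removeAt; transpose)
open import Data.Vec.Functional.Relation.Binary.Pointwise using (Pointwise)
open import Function.Base using (_∘_)
open import Relation.Binary.Bundles using (DecTotalOrder)
import Relation.Binary.Construct.Flip.EqAndOrd as Flip
open import Relation.Binary.PropositionalEquality.Core as ≡ using (_≡_; _≢_)
import Relation.Binary.PropositionalEquality.Properties as ≡
import Relation.Binary.Reasoning.PartialOrder as PartialOrderReasoning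
open import Relation.Nullary.Decidable using (does; yes; no; dec-true; dec-false)
open import Relation.Nullary.Negation.Core using (¬_; contradiction)
open import Relation.Unary using (_∈_)

module _ {c ℓ₁ ℓ₂} (ℝ : RealNumbers c ℓ₁ ℓ₂) where

  open RealNumbers ℝ
  open OWL ℝ
  open DecTotalOrder decTotalOrder
    using (poset; totalOrder; _≤?_; _≟_; total; antisym; ≤-respˡ-≈; ≤-respʳ-≈)
    renaming (refl to ≤-refl; trans to ≤-trans; reflexive to ≤-reflexive)
  open CommutativeRing commutativeRing
    using ( semiring; commutativeSemiring; ring; +-abelianGroup
          ; refl; sym; trans; +-cong; +-congˡ; +-congʳ; *-cong; *-congˡ; *-congʳ
          ; +-identityˡ; +-identityʳ; *-identityˡ; *-identityʳ; zeroˡ; zeroʳ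
          ; -‿cong; -‿inverseʳ; +-assoc; +-comm; *-comm; *-assoc; distribˡ; _-_)
    renaming (reflexive to ≈-reflexive)
  open AbelianGroupProperties +-abelianGroup
    using (xyx⁻¹≈y) renaming (⁻¹-involutive to -‿involutive; ε⁻¹≈ε to -0≈0)
  open RingProperties ring using (-‿distribˡ-*; -‿distribʳ-*; -1*x≈-x)
  open SemiringSum semiring
  open SemiringSolver commutativeSemiring using (solve; _:+_; _:*_; _:=_)
  open PartialOrderReasoning poset
  open Sort (Flip.decTotalOrder decTotalOrder) using (sort; sort-↭; sort-↗)

  private
    variable
      n : ℕ

  -- Ordered fields

  +-monoʳ-≤ : ∀ z {x y} → x ≤ y → z + x ≤ z + y
  +-monoʳ-≤ z {x} {y} x≤y = begin
    z + x ≈⟨ +-comm z x ⟩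
    x + z ≤⟨ +-monoˡ-≤ z x≤y ⟩
    y + z ≈⟨ +-comm y z ⟩
    z + y ∎

  +-mono-≤ : ∀ {x y u v} → x ≤ y → u ≤ v → x + u ≤ y + v
  +-mono-≤ {y = y} {u} x≤y u≤v = ≤-trans (+-monoˡ-≤ u x≤y) (+-monoʳ-≤ y u≤v)

  +-cancelˡ-≤ : ∀ z {x y} → z + x ≤ z + y → x ≤ y
  +-cancelˡ-≤ z {x} {y} z+x≤z+y = begin
    x         ≈⟨ xyx⁻¹≈y z x ⟨
    z + x - z ≤⟨ +-monoˡ-≤ (- z) z+x≤z+y ⟩
    z + y - z ≈⟨ xyx⁻¹≈y z y ⟩
    y         ∎

  ≤⇒∃+ : ∀ {x y} → x ≤ y → ∃ λ d → 0# ≤ d × y ≈ x + d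
  ≤⇒∃+ {x} {y} x≤y = y - x , 0≤y-x , y≈x+[y-x]
    where
    0≤y-x : 0# ≤ y - x
    0≤y-x = begin
      0#    ≈⟨ -‿inverseʳ x ⟨
      x - x ≤⟨ +-monoˡ-≤ (- x) x≤y ⟩
      y - x ∎

    y≈x+[y-x] : y ≈ x + (y - x)
    y≈x+[y-x] = trans (sym (xyx⁻¹≈y x y)) (+-assoc x y (- x))

  x≤x+nonNeg : ∀ {x d} → 0# ≤ d → x ≤ x + d
  x≤x+nonNeg {x} {d} 0≤d = begin
    x      ≈⟨ +-identityʳ x ⟨
    x + 0# ≤⟨ +-monoʳ-≤ x 0≤d ⟩
    x + d  ∎

  -- The two sides differ by `(a - b) * (x - y)`, a product of non-negative factors. This two-term
  -- exchange drives the monotonicity of multiplication, the rearrangement inequality and Abel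
  -- summation alike.
  rearrange₂ : ∀ {a b x y} → b ≤ a → y ≤ x → a * y + b * x ≤ a * x + b * y
  rearrange₂ {a} {b} {x} {y} b≤a y≤x with ≤⇒∃+ b≤a | ≤⇒∃+ y≤x
  ... | p , 0≤p , a≈b+p | q , 0≤q , x≈y+q = begin
    a * y + b * x                       ≈⟨ +-cong (*-congʳ a≈b+p) (*-congˡ x≈y+q) ⟩
    (b + p) * y + b * (y + q)           ≤⟨ x≤x+nonNeg (*-nonNeg 0≤p 0≤q) ⟩
    (b + p) * y + b * (y + q) + p * q
      ≈⟨ solve 4 (λ b p q y → (b :+ p) :* y :+ b :* (y :+ q) :+ p :* q
                           := (b :+ p) :* (y :+ q) :+ b :* y) refl b p q y ⟩
    (b + p) * (y + q) + b * y           ≈⟨ +-congʳ (*-cong a≈b+p x≈y+q) ⟨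
    a * x + b * y                       ∎

  *-monoˡ-nonNeg : ∀ {a x y} → 0# ≤ a → x ≤ y → a * x ≤ a * y
  *-monoˡ-nonNeg {a} {x} {y} 0≤a x≤y = begin
    a * x          ≈⟨ trans (+-congˡ (zeroˡ y)) (+-identityʳ (a * x)) ⟨
    -- The exchange with second coefficient `0#` is monotonicity.
    a * x + 0# * y ≤⟨ rearrange₂ 0≤a x≤y ⟩
    a * y + 0# * x ≈⟨ trans (+-congˡ (zeroˡ x)) (+-identityʳ (a * y)) ⟩
    a * y          ∎

  x≤0⇒0≤-x : ∀ {x} → x ≤ 0# → 0# ≤ - x
  x≤0⇒0≤-x {x} x≤0 = begin
    0#     ≈⟨ -‿inverseʳ x ⟨
    x - x  ≤⟨ +-monoˡ-≤ (- x) x≤0 ⟩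
    0# - x ≈⟨ +-identityˡ (- x) ⟩
    - x    ∎

  0≤x⇒-x≤0 : ∀ {x} → 0# ≤ x → - x ≤ 0#
  0≤x⇒-x≤0 {x} 0≤x = begin
    - x    ≈⟨ +-identityˡ (- x) ⟨
    0# - x ≤⟨ +-monoˡ-≤ (- x) 0≤x ⟩
    x - x  ≈⟨ -‿inverseʳ x ⟩
    0#     ∎

  ≰⇒≥ : ∀ {x y} → ¬ (x ≤ y) → y ≤ x
  ≰⇒≥ {x} {y} x≰y with total x y
  ... | inj₁ x≤y = contradiction x≤y x≰y
  ... | inj₂ y≤x = y≤x

  -x*-y≈x*y : ∀ x y → - x * - y ≈ x * y
  -x*-y≈x*y x y = begin-equality
    - x * - y   ≈⟨ -‿distribˡ-* x (- y) ⟨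
    - (x * - y) ≈⟨ -‿cong (-‿distribʳ-* x y) ⟨
    - - (x * y) ≈⟨ -‿involutive (x * y) ⟩
    x * y       ∎

  -- If `1# ≤ 0#` then `- 1#` is non-negative, so its square `1#` is too, and antisymmetry collapses
  -- the field.
  1≰0 : ¬ (1# ≤ 0#)
  1≰0 1≤0 = 0≉1 (antisym 0≤1 1≤0)
    where
    0≤1 : 0# ≤ 1#
    0≤1 = begin
      0#          ≤⟨ *-nonNeg (x≤0⇒0≤-x 1≤0) (x≤0⇒0≤-x 1≤0) ⟩
      - 1# * - 1# ≈⟨ -x*-y≈x*y 1# 1# ⟩
      1# * 1#     ≈⟨ *-identityˡ 1# ⟩
      1#          ∎

  ⁻¹-nonNeg : ∀ {x} → 0# ≤ x → x ≉ 0# → 0# ≤ x ⁻¹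
  ⁻¹-nonNeg {x} 0≤x x≉0 with 0# ≤? x ⁻¹
  ... | yes 0≤x⁻¹ = 0≤x⁻¹
  ... | no  0≰x⁻¹ = contradiction 1≤0 1≰0
    where
    1≤0 : 1# ≤ 0#
    1≤0 = begin
      1#       ≈⟨ ⁻¹-inverseʳ x x≉0 ⟨
      x * x ⁻¹ ≤⟨ *-monoˡ-nonNeg 0≤x (≰⇒≥ 0≰x⁻¹) ⟩
      x * 0#   ≈⟨ zeroʳ x ⟩
      0#       ∎

  -- Absolute value and sign

  -- The scalar maps behind `∣_∣` and `sign`, named for case analysis one entry at a time; `∣ x ∣ i`
  -- is definitionally `abs (x i)`.
  abs : Carrier → Carrier
  abs a = if does (0# ≤? a) then a else - a

  sgn : Carrier → Carrier
  sgn a = if does (a ≟ 0#) then 0# else (if does (0# ≤? a) then 1# else - 1#)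

  abs-nonNeg : ∀ a → 0# ≤ abs a
  abs-nonNeg a with 0# ≤? a
  ... | yes 0≤a = 0≤a
  ... | no  0≰a = x≤0⇒0≤-x (≰⇒≥ 0≰a)

  abs-least : ∀ {a t} → a ≤ t → - a ≤ t → abs a ≤ t
  abs-least {a} a≤t -a≤t with 0# ≤? a
  ... | yes _ = a≤t
  ... | no  _ = -a≤t

  -- Equal signs give equality; with opposite signs, negating the negative factor can only raise the
  -- product.
  *≤abs*abs : ∀ a b → a * b ≤ abs a * abs b
  *≤abs*abs a b with 0# ≤? a | 0# ≤? b
  ... | yes _   | yes _   = ≤-refl
  ... | no  _   | no  _   = ≤-reflexive (sym (-x*-y≈x*y a b))
  ... | yes 0≤a | no  0≰b =
    *-monoˡ-nonNeg 0≤a (≤-trans (≰⇒≥ 0≰b) (x≤0⇒0≤-x (≰⇒≥ 0≰b)))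
  ... | no  0≰a | yes 0≤b = begin
    a * b   ≈⟨ *-comm a b ⟩
    b * a   ≤⟨ *-monoˡ-nonNeg 0≤b (≤-trans (≰⇒≥ 0≰a) (x≤0⇒0≤-x (≰⇒≥ 0≰a))) ⟩
    b * - a ≈⟨ *-comm b (- a) ⟩
    - a * b ∎

  sgn-* : ∀ a → sgn a * a ≈ abs a
  sgn-* a with a ≟ 0# | 0# ≤? a
  ... | yes a≈0 | yes _   = trans (zeroˡ a) (sym a≈0)
  ... | yes a≈0 | no  0≰a = contradiction (≤-reflexive (sym a≈0)) 0≰a
  ... | no  _   | yes _   = *-identityˡ a
  ... | no  _   | no  _   = -1*x≈-x a

  sgn-*-≤ : ∀ a {t} → 0# ≤ t → sgn a * t ≤ t
  sgn-*-≤ a {t} 0≤t with a ≟ 0# | 0# ≤? a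
  ... | yes _ | _     = ≤-respˡ-≈ (sym (zeroˡ t)) 0≤t
  ... | no  _ | yes _ = ≤-reflexive (*-identityˡ t)
  ... | no  _ | no  _ = ≤-respˡ-≈ (sym (-1*x≈-x t)) (≤-trans (0≤x⇒-x≤0 0≤t) 0≤t)

  -sgn-*-≤ : ∀ a {t} → 0# ≤ t → - (sgn a * t) ≤ t
  -sgn-*-≤ a {t} 0≤t with a ≟ 0# | 0# ≤? a
  ... | yes _ | _     = ≤-respˡ-≈ (sym (trans (-‿cong (zeroˡ t)) -0≈0)) 0≤t
  ... | no  _ | yes _ =
    ≤-respˡ-≈ (sym (-‿cong (*-identityˡ t))) (≤-trans (0≤x⇒-x≤0 0≤t) 0≤t)
  ... | no  _ | no  _ =
    ≤-reflexive (trans (-‿cong (-1*x≈-x t)) (-‿involutive t))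

  -- An inequality, not an equation: where `a` is zero, so is `sgn a`, and the left side vanishes
  -- whatever `t` is. Feasibility of the final vector needs only the upper bound.
  abs-scaled-sgn : ∀ {ε t} a → 0# ≤ ε → 0# ≤ t → abs (ε * (sgn a * t)) ≤ ε * t
  abs-scaled-sgn {ε} {t} a 0≤ε 0≤t = abs-least
    (*-monoˡ-nonNeg 0≤ε (sgn-*-≤ a 0≤t))
    (≤-respˡ-≈ (sym (-‿distribʳ-* ε (sgn a * t))) (*-monoˡ-nonNeg 0≤ε (-sgn-*-≤ a 0≤t)))

  -- Sums and inner products

  sum-mono : (x y : Vec n) → (∀ i → x i ≤ y i) → sum x ≤ sum y
  sum-mono {ℕ.zero} x y x≤y = ≤-refl
  sum-mono {suc n}  x y x≤y = +-mono-≤ (x≤y zero) (sum-mono (tail x) (tail y) (x≤y ∘ suc))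

  sum-single : (x : Vec n) (k : Fin n) → (∀ j → k ≢ j → x j ≈ 0#) → sum x ≈ x k
  sum-single {suc n} x k x≈0 = begin-equality
    sum x                     ≈⟨ sum-remove {i = k} x ⟩
    x k + sum (removeAt x k)
      ≈⟨ +-congˡ (sum-cong-≋ λ j → x≈0 (punchIn k j) (Fin.punchInᵢ≢i k j ∘ ≡.sym)) ⟩
    x k + sum {n} 𝟎           ≈⟨ +-congˡ (sum-replicate-zero n) ⟩
    x k + 0#                  ≈⟨ +-identityʳ (x k) ⟩
    x k                       ∎

  ·-comm : (x y : Vec n) → x · y ≈ y · x
  ·-comm x y = sum-cong-≋ λ i → *-comm (x i) (y i)

  ·-•ʳ : (a : Carrier) (x y : Vec n) → x · (a • y) ≈ a * (x · y)
  ·-•ʳ a x y = begin-equality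
    x · (a • y)
      ≈⟨ sum-cong-≋ (λ i → solve 3 (λ a x y → x :* (a :* y) := a :* (x :* y)) refl a (x i) (y i)) ⟩
    sum (a • (x ⊙ y))
      ≈⟨ *-distribˡ-sum a (x ⊙ y) ⟨
    a * (x · y)
      ∎

  ·-monoʳ : (w x y : Vec n) → (∀ i → 0# ≤ w i) → (∀ i → x i ≤ y i) → w · x ≤ w · y
  ·-monoʳ w x y 0≤w x≤y = sum-mono (w ⊙ x) (w ⊙ y) λ i → *-monoˡ-nonNeg (0≤w i) (x≤y i)

  ·-nonNeg : (x y : Vec n) → (∀ i → 0# ≤ x i) → (∀ i → 0# ≤ y i) → 0# ≤ x · y
  ·-nonNeg {n} x y 0≤x 0≤y = begin
    0#        ≈⟨ sum-replicate-zero n ⟨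
    sum {n} 𝟎 ≤⟨ sum-mono 𝟎 (x ⊙ y) (λ i → *-nonNeg (0≤x i) (0≤y i)) ⟩
    x · y     ∎

  -- The rearrangement inequality

  Antitone : Vec n → Set ℓ₂
  Antitone x = ∀ i j → i Fin.≤ j → x j ≤ x i

  Antitone-tail : (x : Vec (suc n)) → Antitone x → Antitone (tail x)
  Antitone-tail x x↘ i j i≤j = x↘ (suc i) (suc j) (s≤s i≤j)

  -- Bringing entry `k` to the front shifts the entries before it one place down. By induction it
  -- reaches the front of the tail, and one exchange carries it past the head.
  ·-moveToFront : (a x : Vec (suc n)) → Antitone a → Antitone x → ∀ k →
                  head a * x k + tail a · removeAt x k ≤ a · x
  ·-moveToFront         a x a↘ x↘ zero    = ≤-refl
  -- The term `a₁ * xₖ` added to both sides is what the exchange produces on the right and the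
  -- induction hypothesis consumes on the left.
  ·-moveToFront {suc n} a x a↘ x↘ (suc k) = +-cancelˡ-≤ (a₁ * xₖ) (begin
    a₁ * xₖ + (a₀ * xₖ + (a₁ * x₀ + r))
      ≈⟨ solve 4 (λ p q s r → p :+ (q :+ (s :+ r)) := (q :+ s) :+ (p :+ r)) refl
               (a₁ * xₖ) (a₀ * xₖ) (a₁ * x₀) r ⟩
    (a₀ * xₖ + a₁ * x₀) + (a₁ * xₖ + r)
      ≤⟨ +-mono-≤ (rearrange₂ (a↘ zero (suc zero) z≤n) (x↘ zero (suc k) z≤n))
                  (·-moveToFront (tail a) (tail x) (Antitone-tail a a↘) (Antitone-tail x x↘) k) ⟩
    (a₀ * x₀ + a₁ * xₖ) + tail a · tail x
      ≈⟨ solve 3 (λ p q t → (p :+ q) :+ t := q :+ (p :+ t)) refl (a₀ * x₀) (a₁ * xₖ) (tail a · tail x) ⟩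
    a₁ * xₖ + (a₀ * x₀ + tail a · tail x)
      ∎)
    where
    a₀ a₁ x₀ xₖ r : Carrier
    a₀ = a zero
    a₁ = a (suc zero)
    x₀ = x zero
    xₖ = x (suc k)
    r  = tail (tail a) · removeAt (tail x) k

  -- Split off the entry `x k` that `π` puts first. What remains is a permutation of `removeAt x k`,
  -- which is still antitone, so induction sorts it and `·-moveToFront` puts `x k` back in place.
  rearrangement : (a x : Vec n) → Antitone a → Antitone x → (π : Permutation′ n) →
                  a · (x ∘ (π ⟨$⟩ʳ_)) ≤ a · x
  rearrangement {ℕ.zero} a x a↘ x↘ π = ≤-refl
  rearrangement {suc n}  a x a↘ x↘ π = begin
    head a * x k + tail a · (x ∘ (π ⟨$⟩ʳ_) ∘ suc)
      -- Past position zero, `π` is `Perm.remove zero π` followed by the embedding that skips `k`.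
      ≈⟨ +-congˡ (sum-cong-≋ λ i →
           *-congˡ (≈-reflexive (≡.cong x (Perm.punchIn-permute π zero i)))) ⟩
    head a * x k + tail a · (removeAt x k ∘ (Perm.remove zero π ⟨$⟩ʳ_))
      ≤⟨ +-monoʳ-≤ (head a * x k)
           (rearrangement (tail a) (removeAt x k) (Antitone-tail a a↘)
              (λ i j i≤j → x↘ (punchIn k i) (punchIn k j) (Fin.punchIn-mono-≤ k i j i≤j))
              (Perm.remove zero π)) ⟩
    head a * x k + tail a · removeAt x k
      ≤⟨ ·-moveToFront a x a↘ x↘ k ⟩
    a · x
      ∎
    where
    k : Fin (suc n)
    k = π ⟨$⟩ʳ zero

  -- Prefix sums and Abel summation

  -- The sum includes entry `i`, matching the `toℕ i + 1` terms in `τ`; recursion on the index suits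
  -- the inductions better than a sum over `inject≤`.
  prefixSum : Vec n → Fin n → Carrier
  prefixSum x zero    = head x
  prefixSum x (suc i) = head x + prefixSum (tail x) i

  sum-inject≤ : (x : Vec n) (i : Fin n) →
                sum (λ j → x (inject≤ {suc (toℕ i)} j (Fin.toℕ<n i))) ≈ prefixSum x i
  sum-inject≤ x zero    = +-identityʳ (head x)
  sum-inject≤ x (suc i) = +-congˡ (sum-inject≤ (tail x) i)

  -- For `t = τ w i` the vector on the left is `b w i`. A free `t` lets the induction pass to tails
  -- while the scale stays fixed.
  indicator-·≈*prefixSum : (t : Carrier) (x : Vec n) (i : Fin n) →
    (λ k → if does (k Fin.≤? i) then t else 0#) · x ≈ t * prefixSum x i
  indicator-·≈*prefixSum {suc n} t x zero = begin-equality
    t * head x + 𝟎 · tail x    ≈⟨ +-congˡ (sum-cong-≋ λ j → zeroˡ (tail x j)) ⟩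
    t * head x + sum {n} 𝟎     ≈⟨ +-congˡ (sum-replicate-zero n) ⟩
    t * head x + 0#            ≈⟨ +-identityʳ (t * head x) ⟩
    t * head x                 ∎
  indicator-·≈*prefixSum {suc n} t x (suc i) = begin-equality
    t * head x + (λ k → if does (suc k Fin.≤? suc i) then t else 0#) · tail x
      -- The two comparisons reduce to the same boolean once `k` is split into constructors.
      ≈⟨ +-congˡ (sum-cong-≋ {n} λ { zero → refl ; (suc k) → refl }) ⟩
    t * head x + (λ k → if does (k Fin.≤? i) then t else 0#) · tail x
      ≈⟨ +-congˡ (indicator-·≈*prefixSum t (tail x) i) ⟩
    t * head x + t * prefixSum (tail x) i
      ≈⟨ distribˡ t (head x) (prefixSum (tail x) i) ⟨
    t * (head x + prefixSum (tail x) i)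
      ∎

  prefixSum-• : (a : Carrier) (x : Vec n) (i : Fin n) → prefixSum (a • x) i ≈ a * prefixSum x i
  prefixSum-• a x zero    = refl
  prefixSum-• a x (suc i) = trans (+-congˡ (prefixSum-• a (tail x) i)) (sym (distribˡ a _ _))

  prefixSum-nonNeg : (x : Vec n) → (∀ i → 0# ≤ x i) → ∀ i → 0# ≤ prefixSum x i
  prefixSum-nonNeg x 0≤x zero    = 0≤x zero
  prefixSum-nonNeg x 0≤x (suc i) =
    ≤-trans (0≤x zero) (x≤x+nonNeg (prefixSum-nonNeg (tail x) (0≤x ∘ suc) i))

  head≤prefixSum : (x : Vec (suc n)) → (∀ i → 0# ≤ x i) → ∀ i → head x ≤ prefixSum x i
  head≤prefixSum         x 0≤x zero    = ≤-refl
  head≤prefixSum {suc n} x 0≤x (suc i) = x≤x+nonNeg (prefixSum-nonNeg (tail x) (0≤x ∘ suc) i)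

  -- Each entry lies between zero and the head, and the head is at most any prefix sum. Applied to
  -- `w`, this makes every prefix sum of the weights invertible.
  prefixSum≈0⇒≋𝟎 : (x : Vec n) → x ∈ MonotoneNonNegative →
                   ∀ i → prefixSum x i ≈ 0# → Pointwise _≈_ x 𝟎
  prefixSum≈0⇒≋𝟎 {suc n} x (x↘ , 0≤x) i Xᵢ≈0 j = antisym (begin
    x j           ≤⟨ x↘ zero j z≤n ⟩
    head x        ≤⟨ head≤prefixSum x 0≤x i ⟩
    prefixSum x i ≈⟨ Xᵢ≈0 ⟩
    0#            ∎) (0≤x j)

  -- The terms u * p and u * q stand for the part of the sum that has already
  -- been consumed; prepending them is what makes the induction go through.
  ·-mono-prefixSum-acc : (v x y : Vec n) → v ∈ MonotoneNonNegative →
    ∀ {u p q} → (∀ i → v i ≤ u) → 0# ≤ u → p ≤ q →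
    (∀ i → p + prefixSum x i ≤ q + prefixSum y i) → u * p + v · x ≤ u * q + v · y
  ·-mono-prefixSum-acc {ℕ.zero} v x y v∈𝒦 v≤u 0≤u p≤q _ = +-monoˡ-≤ 0# (*-monoˡ-nonNeg 0≤u p≤q)
  ·-mono-prefixSum-acc {suc n} v x y (v↘ , 0≤v) {u} {p} {q} v≤u 0≤u p≤q prefix≤ =
    -- The added terms allow the exchange `u * p + v₀ * q ≤ u * q + v₀ * p`, which lowers the weight
    -- of the consumed part from `u` to `v₀`. The induction then continues with `p + x₀` and
    -- `q + y₀`.
    +-cancelˡ-≤ (v₀ * p + v₀ * q) (begin
      (v₀ * p + v₀ * q) + (u * p + (v₀ * x₀ + r))
        ≈⟨ solve 6 (λ u p q v x r → (v :* p :+ v :* q) :+ (u :* p :+ (v :* x :+ r))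
                                 := (u :* p :+ v :* q) :+ (v :* (p :+ x) :+ r)) refl u p q v₀ x₀ r ⟩
      (u * p + v₀ * q) + (v₀ * (p + x₀) + r)
        ≤⟨ +-mono-≤ (rearrange₂ (v≤u zero) p≤q) (·-mono-prefixSum-acc (tail v) (tail x) (tail y)
             (Antitone-tail v v↘ , 0≤v ∘ suc) (λ i → v↘ zero (suc i) z≤n) (0≤v zero) (prefix≤ zero)
             λ i → ≤-respˡ-≈ (sym (+-assoc p x₀ _)) (≤-respʳ-≈ (sym (+-assoc q y₀ _)) (prefix≤ (suc i)))) ⟩
      (u * q + v₀ * p) + (v₀ * (q + y₀) + s)
        ≈⟨ solve 6 (λ u p q v y s → (u :* q :+ v :* p) :+ (v :* (q :+ y) :+ s)
                                 := (v :* p :+ v :* q) :+ (u :* q :+ (v :* y :+ s))) refl u p q v₀ y₀ s ⟩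
      (v₀ * p + v₀ * q) + (u * q + (v₀ * y₀ + s))
        ∎)
    where
    v₀ x₀ y₀ r s : Carrier
    v₀ = head v
    x₀ = head x
    y₀ = head y
    r  = tail v · tail x
    s  = tail v · tail y

  -- Summation by parts writes `v · x` as a combination of prefix sums of `x`; the coefficients are
  -- the successive drops of `v` and its last entry, all non-negative on the cone.
  ·-mono-prefixSum : (v x y : Vec n) → v ∈ MonotoneNonNegative →
                     (∀ i → prefixSum x i ≤ prefixSum y i) → v · x ≤ v · y
  ·-mono-prefixSum {ℕ.zero} v x y _ _ = ≤-refl
  -- Nothing is consumed yet: `p` and `q` are `0#`, and `head v` serves as the bound `u`.
  ·-mono-prefixSum {suc n} v x y v∈𝒦@(v↘ , 0≤v) prefix≤ = +-cancelˡ-≤ (head v * 0#)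
    (·-mono-prefixSum-acc v x y v∈𝒦 (λ i → v↘ zero i z≤n) (0≤v zero) ≤-refl
      (λ i → +-monoʳ-≤ 0# (prefix≤ i)))

  -- Sorting

  ↓-permutes : (x : Vec n) → ∃ λ (σ : Permutation′ n) → ∀ i → (x ↓) i ≡ x (σ ⟨$⟩ʳ i)
  ↓-permutes {n} x = σ , x↓≡x∘σ
    where
    xs↭ = Permutation.↭⇒↭ₛ (sort-↭ (List.tabulate x))
    ρ   = Permutation.onIndices xs↭
    length-xs : List.length (List.tabulate x) ≡ n
    length-xs = List.length-tabulate x
    -- `Fin.cast` ignores which proof of the equation it is given, so this cast agrees with the one
    -- inside `_↓`.
    length-sort : n ≡ List.length (sort (List.tabulate x))
    length-sort = ≡.trans (≡.sym length-xs) (≡.sym (↭-length (sort-↭ (List.tabulate x))))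
    σ : Permutation′ n
    σ = Perm.cast-id length-sort ∘ₚ ρ ∘ₚ Perm.cast-id length-xs

    lookup-tabulate′ : ∀ i → List.lookup (List.tabulate x) i ≡ x (Fin.cast length-xs i)
    lookup-tabulate′ i = ≡.trans
      (≡.cong (List.lookup (List.tabulate x)) (≡.sym (Fin.cast-involutive (≡.sym length-xs) length-xs i)))
      (List.lookup-tabulate x (Fin.cast length-xs i))

    x↓≡x∘σ : ∀ i → (x ↓) i ≡ x (σ ⟨$⟩ʳ i)
    x↓≡x∘σ i = ≡.trans
      (Permutation.onIndices-lookup (≡.setoid Carrier) xs↭ (Fin.cast length-sort i))
      (lookup-tabulate′ (ρ ⟨$⟩ʳ Fin.cast length-sort i))

  ↓-antitone : (x : Vec n) → Antitone (x ↓)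
  -- Monotone for the flipped order means antitone for `_≤_`.
  ↓-antitone x i j i≤j = Sorted.lookup-mono-≤ (Flip.totalOrder totalOrder)
    (sort-↗ (List.tabulate x))
    (≡.subst₂ ℕ._≤_ (≡.sym (Fin.toℕ-cast _ i)) (≡.sym (Fin.toℕ-cast _ j)) i≤j)

  ↓-nonNeg : (x : Vec n) → (∀ i → 0# ≤ x i) → ∀ i → 0# ≤ (x ↓) i
  ↓-nonNeg x 0≤x i with ↓-permutes x
  ... | σ , x↓≡x∘σ = ≡.subst (0# ≤_) (≡.sym (x↓≡x∘σ i)) (0≤x (σ ⟨$⟩ʳ i))

  -- Reindexing both vectors by the permutation that sorts `x` leaves `y` as some permutation of
  -- `y ↓`, and the rearrangement inequality applies.
  ·≤↓·↓ : (x y : Vec n) → x · y ≤ x ↓ · y ↓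
  ·≤↓·↓ x y with ↓-permutes x | ↓-permutes y
  ... | σ , x↓≡x∘σ | ρ , y↓≡y∘ρ = begin
    x · y                                 ≈⟨ sum-permute (x ⊙ y) σ ⟩
    (x ∘ (σ ⟨$⟩ʳ_)) · (y ∘ (σ ⟨$⟩ʳ_))     ≡⟨ sum-cong-≗ (λ i → ≡.cong₂ _*_ (≡.sym (x↓≡x∘σ i)) (y∘σ≡y↓∘π i)) ⟩
    x ↓ · ((y ↓) ∘ (π ⟨$⟩ʳ_))             ≤⟨ rearrangement (x ↓) (y ↓) (↓-antitone x) (↓-antitone y) π ⟩
    x ↓ · y ↓                             ∎
    where
    π = σ ∘ₚ Perm.flip ρ

    y∘σ≡y↓∘π : ∀ i → y (σ ⟨$⟩ʳ i) ≡ (y ↓) (π ⟨$⟩ʳ i)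
    y∘σ≡y↓∘π i = ≡.sym (≡.trans (y↓≡y∘ρ (π ⟨$⟩ʳ i)) (≡.cong y (Perm.inverseʳ ρ)))

  -- Permutation matrices

  module _ (P : Matrix n n) (π : Permutation′ n)
           (P≈ : ∀ i j → P i j ≈ (if does (π ⟨$⟩ʳ i Fin.≟ j) then 1# else 0#)) where

    private
      P-on : ∀ {i j} → π ⟨$⟩ʳ i ≡ j → P i j ≈ 1#
      P-on {i} {j} πi≡j with P≈ i j
      ... | Pij≈ rewrite dec-true (π ⟨$⟩ʳ i Fin.≟ j) πi≡j = Pij≈

      P-off : ∀ {i j} → π ⟨$⟩ʳ i ≢ j → P i j ≈ 0#
      P-off {i} {j} πi≢j with P≈ i j
      ... | Pij≈ rewrite dec-false (π ⟨$⟩ʳ i Fin.≟ j) πi≢j = Pij≈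

    permutationMatrix-*ᵥ : ∀ x i → (P *ᵥ x) i ≈ x (π ⟨$⟩ʳ i)
    permutationMatrix-*ᵥ x i = begin-equality
      P i · x                         ≈⟨ sum-single (P i ⊙ x) (π ⟨$⟩ʳ i) (λ j πi≢j →
                                           trans (*-congʳ (P-off πi≢j)) (zeroˡ (x j))) ⟩
      P i (π ⟨$⟩ʳ i) * x (π ⟨$⟩ʳ i)   ≈⟨ *-congʳ (P-on ≡.refl) ⟩
      1# * x (π ⟨$⟩ʳ i)               ≈⟨ *-identityˡ (x (π ⟨$⟩ʳ i)) ⟩
      x (π ⟨$⟩ʳ i)                    ∎

    -- Column `j` of `P` has its only one in the row that `π` sends to `j`, so the transpose
    -- reindexes by the inverse permutation.
    permutationMatrixᵀ-*ᵥ : ∀ x j → (transpose P *ᵥ x) j ≈ x (π ⟨$⟩ˡ j)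
    permutationMatrixᵀ-*ᵥ x j = begin-equality
      transpose P j · x               ≈⟨ sum-single (transpose P j ⊙ x) (π ⟨$⟩ˡ j) (λ i π⁻¹j≢i →
                                           trans (*-congʳ (P-off λ πi≡j → π⁻¹j≢i (≡.trans
                                             (≡.cong (π ⟨$⟩ˡ_) (≡.sym πi≡j)) (Perm.inverseˡ π)))) (zeroˡ (x i))) ⟩
      P (π ⟨$⟩ˡ j) j * x (π ⟨$⟩ˡ j)   ≈⟨ *-congʳ (P-on (Perm.inverseʳ π)) ⟩
      1# * x (π ⟨$⟩ˡ j)               ≈⟨ *-identityˡ (x (π ⟨$⟩ˡ j)) ⟩
      x (π ⟨$⟩ˡ j)                    ∎

  -- The candidate vectors 𝓑

  module _ (w : Vec n) (w∈𝒦 : w ∈ MonotoneNonNegative) (w≉𝟎 : ¬ (Pointwise _≈_ w 𝟎)) where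

    prefixSum-≉0 : ∀ i → prefixSum w i ≉ 0#
    prefixSum-≉0 i Wᵢ≈0 = w≉𝟎 (prefixSum≈0⇒≋𝟎 w w∈𝒦 i Wᵢ≈0)

    τ≈prefixSum⁻¹ : ∀ i → τ w i ≈ prefixSum w i ⁻¹
    τ≈prefixSum⁻¹ i = ⁻¹-cong (sum-inject≤ w i)

    τ-nonNeg : ∀ i → 0# ≤ τ w i
    τ-nonNeg i = ≤-respʳ-≈ (sym (τ≈prefixSum⁻¹ i))
      (⁻¹-nonNeg (prefixSum-nonNeg w (proj₂ w∈𝒦) i) (prefixSum-≉0 i))

    prefixSum*τ≈1 : ∀ i → prefixSum w i * τ w i ≈ 1#
    prefixSum*τ≈1 i = trans (*-congˡ (τ≈prefixSum⁻¹ i)) (⁻¹-inverseʳ (prefixSum w i) (prefixSum-≉0 i))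

    -- The factor `τ` normalises each candidate: a vector of the cone is its own sorted absolute
    -- value, so this says that `b w i` has OWL norm one.
    w·b≈1 : ∀ i → w · b w i ≈ 1#
    w·b≈1 i = begin-equality
      w · b w i             ≈⟨ ·-comm w (b w i) ⟩
      b w i · w             ≈⟨ indicator-·≈*prefixSum (τ w i) w i ⟩
      τ w i * prefixSum w i ≈⟨ *-comm (τ w i) (prefixSum w i) ⟩
      prefixSum w i * τ w i ≈⟨ prefixSum*τ≈1 i ⟩
      1#                    ∎

    b∈𝒦 : ∀ k → b w k ∈ MonotoneNonNegative
    b∈𝒦 k = b↘ , 0≤b
      where
      0≤b : ∀ i → 0# ≤ b w k i
      0≤b i with does (i Fin.≤? k)
      ... | true  = τ-nonNeg k
      ... | false = ≤-refl

      b↘ : Antitone (b w k)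
      b↘ i j i≤j with j Fin.≤? k
      -- Past the leading block entry `j` is zero and `0≤b` suffices; within it, `i ≤ j` puts `i` in
      -- the block too.
      ... | no  j≰k rewrite dec-false (j Fin.≤? k) j≰k = 0≤b i
      ... | yes j≤k rewrite dec-true (j Fin.≤? k) j≤k
                          | dec-true (i Fin.≤? k) (ℕ.≤-trans i≤j j≤k) = ≤-refl

    -- The product `b w i · x` is `τ w i` times a prefix sum of `x`; multiplying by the non-negative
    -- `prefixSum w i` clears the denominator.
    prefixSum-bounded : ∀ x {M} → (∀ i → b w i · x ≤ M) →
                        ∀ i → prefixSum x i ≤ prefixSum (M • w) i
    prefixSum-bounded x {M} b·x≤M i = begin
      prefixSum x i                             ≈⟨ *-identityˡ (prefixSum x i) ⟨
      1# * prefixSum x i                        ≈⟨ *-congʳ (prefixSum*τ≈1 i) ⟨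
      prefixSum w i * τ w i * prefixSum x i     ≈⟨ *-assoc (prefixSum w i) (τ w i) (prefixSum x i) ⟩
      prefixSum w i * (τ w i * prefixSum x i)   ≈⟨ *-congˡ (indicator-·≈*prefixSum (τ w i) x i) ⟨
      prefixSum w i * (b w i · x)
        ≤⟨ *-monoˡ-nonNeg (prefixSum-nonNeg w (proj₂ w∈𝒦) i) (b·x≤M i) ⟩
      prefixSum w i * M                         ≈⟨ *-comm (prefixSum w i) M ⟩
      M * prefixSum w i                         ≈⟨ prefixSum-• M w i ⟨
      prefixSum (M • w) i                       ∎

    ·-bounded : ∀ x {M ε} → 0# ≤ M → (∀ i → b w i · (∣ x ∣ ↓) ≤ M) →
                ∀ y → Ω w y ≤ ε → y · x ≤ ε * M
    ·-bounded x {M} {ε} 0≤M b·∣x∣≤M y Ωy≤ε = begin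
      y · x                 ≤⟨ sum-mono (y ⊙ x) (∣ y ∣ ⊙ ∣ x ∣) (λ i → *≤abs*abs (y i) (x i)) ⟩
      ∣ y ∣ · ∣ x ∣         ≤⟨ ·≤↓·↓ ∣ y ∣ ∣ x ∣ ⟩
      ∣ y ∣ ↓ · ∣ x ∣ ↓     ≤⟨ ·-mono-prefixSum (∣ y ∣ ↓) (∣ x ∣ ↓) (M • w)
                                 (↓-antitone ∣ y ∣ , ↓-nonNeg ∣ y ∣ (λ i → abs-nonNeg (y i)))
                                 (prefixSum-bounded (∣ x ∣ ↓) b·∣x∣≤M) ⟩
      ∣ y ∣ ↓ · (M • w)     ≈⟨ ·-•ʳ M (∣ y ∣ ↓) w ⟩
      M * (∣ y ∣ ↓ · w)     ≈⟨ *-congˡ (·-comm (∣ y ∣ ↓) w) ⟩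
      -- Here `0# ≤ M` lets the constraint on `y` be scaled by `M`.
      M * Ω w y             ≤⟨ *-monoˡ-nonNeg 0≤M Ωy≤ε ⟩
      M * ε                 ≈⟨ *-comm M ε ⟩
      ε * M                 ∎

    -- Sorting `∣ s ∣` only composes `π` with another permutation, and rearrangement against the
    -- antitone `w` removes the composite, leaving `ε * (w · b w k)`.
    Ω-permuted-b≤ : ∀ {ε} → 0# ≤ ε → ∀ k (π : Permutation′ n) (s : Vec n) →
                    (∀ j → abs (s j) ≤ ε * b w k (π ⟨$⟩ʳ j)) → Ω w s ≤ ε
    Ω-permuted-b≤ {ε} 0≤ε k π s ∣s∣≤ with ↓-permutes ∣ s ∣
    ... | σ , ∣s∣↓≡∣s∣∘σ = begin
      w · (∣ s ∣ ↓)                 ≤⟨ ·-monoʳ w (∣ s ∣ ↓) (ε • (b w k ∘ (ρ ⟨$⟩ʳ_))) (proj₂ w∈𝒦)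
                                         (λ i → ≡.subst (_≤ _) (≡.sym (∣s∣↓≡∣s∣∘σ i)) (∣s∣≤ (σ ⟨$⟩ʳ i))) ⟩
      w · (ε • (b w k ∘ (ρ ⟨$⟩ʳ_))) ≈⟨ ·-•ʳ ε w (b w k ∘ (ρ ⟨$⟩ʳ_)) ⟩
      ε * (w · (b w k ∘ (ρ ⟨$⟩ʳ_))) ≤⟨ *-monoˡ-nonNeg 0≤ε
                                         (rearrangement w (b w k) (proj₁ w∈𝒦) (proj₁ (b∈𝒦 k)) ρ) ⟩
      ε * (w · b w k)               ≈⟨ *-congˡ (w·b≈1 k) ⟩
      ε * 1#                        ≈⟨ *-identityʳ ε ⟩
      ε                             ∎
      where
      ρ : Permutation′ n
      ρ = σ ∘ₚ π

  -- Feasibility and optimality of the constructed vector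

  OWL-maximizer : ∀ (n : ℕ) (w : Vec n) (ε : Carrier) (g : Vec n) →
    w ∈ MonotoneNonNegative →
    ¬ (Pointwise _≈_ w 𝟎) →
    0# < ε →
    ∀ (P : Matrix n n) → IsSortingMatrix P ∣ g ∣ →
    ∀ (b̂ : Vec n) → b̂ ∈ ArgMax (𝓑 w) (λ x → x · (∣ g ∣ ↓)) →
    (ε • (sign g ⊙ (transpose P *ᵥ b̂))) ∈ ArgMax (λ s → Ω w s ≤ ε) (λ s → s · g)
  OWL-maximizer n w ε g w∈𝒦 w≉𝟎 (0≤ε , _) P ((π , P≈) , ∣g∣↓≈P∣g∣) b̂ ((k , b̂≈b) , b·∣g∣≤M) =
    -- The transpose undoes the sorting, so the permutation acting on `b̂` is the inverse of `π`.
    Ω-permuted-b≤ w w∈𝒦 w≉𝟎 0≤ε k (Perm.flip π) s ∣s∣≤ ,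
    λ y Ωy≤ε → ≤-respʳ-≈ (sym s·g≈ε*M)
      (·-bounded w w∈𝒦 w≉𝟎 g 0≤M (λ i → b·∣g∣≤M (b w i) (i , λ _ → refl)) y Ωy≤ε)
    where
    s : Vec n
    s = ε • (sign g ⊙ (transpose P *ᵥ b̂))

    M : Carrier
    M = b̂ · (∣ g ∣ ↓)

    0≤b̂ : ∀ i → 0# ≤ b̂ i
    0≤b̂ i = ≤-respʳ-≈ (sym (b̂≈b i)) (proj₂ (b∈𝒦 w w∈𝒦 w≉𝟎 k) i)

    0≤M : 0# ≤ M
    0≤M = ·-nonNeg b̂ (∣ g ∣ ↓) 0≤b̂ (↓-nonNeg ∣ g ∣ (λ i → abs-nonNeg (g i)))

    Pᵀb̂≈ : ∀ j → (transpose P *ᵥ b̂) j ≈ b̂ (π ⟨$⟩ˡ j)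
    Pᵀb̂≈ = permutationMatrixᵀ-*ᵥ P π P≈ b̂

    ∣s∣≤ : ∀ j → abs (s j) ≤ ε * b w k (π ⟨$⟩ˡ j)
    ∣s∣≤ j = ≤-respʳ-≈ (*-congˡ (trans (Pᵀb̂≈ j) (b̂≈b (π ⟨$⟩ˡ j))))
      (abs-scaled-sgn (g j) 0≤ε (≤-respʳ-≈ (sym (Pᵀb̂≈ j)) (0≤b̂ (π ⟨$⟩ˡ j))))

    s·g≈ε*M : s · g ≈ ε * M
    s·g≈ε*M = begin-equality
      s · g
        ≈⟨ sum-cong-≋ (λ j → begin-equality
             ε * (sgn (g j) * (transpose P *ᵥ b̂) j) * g j
               ≈⟨ solve 4 (λ e c t x → e :* (c :* t) :* x := e :* (t :* (c :* x))) refl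
                        ε (sgn (g j)) ((transpose P *ᵥ b̂) j) (g j) ⟩
             ε * ((transpose P *ᵥ b̂) j * (sgn (g j) * g j))
               ≈⟨ *-congˡ (*-cong (Pᵀb̂≈ j) (sgn-* (g j))) ⟩
             ε * (b̂ (π ⟨$⟩ˡ j) * abs (g j))
               ∎) ⟩
      sum (ε • ((b̂ ∘ (π ⟨$⟩ˡ_)) ⊙ ∣ g ∣))
        ≈⟨ *-distribˡ-sum ε ((b̂ ∘ (π ⟨$⟩ˡ_)) ⊙ ∣ g ∣) ⟨
      ε * ((b̂ ∘ (π ⟨$⟩ˡ_)) · ∣ g ∣)
        -- Reindexing by `π` cancels its inverse on `b̂` and turns `∣ g ∣` into `P *ᵥ ∣ g ∣`, which
        -- is `∣ g ∣ ↓` by the choice of `P`.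
        ≈⟨ *-congˡ (sum-permute ((b̂ ∘ (π ⟨$⟩ˡ_)) ⊙ ∣ g ∣) π) ⟩
      ε * sum (λ i → b̂ (π ⟨$⟩ˡ (π ⟨$⟩ʳ i)) * abs (g (π ⟨$⟩ʳ i)))
        ≈⟨ *-congˡ (sum-cong-≋ λ i → *-cong
             (≈-reflexive (≡.cong b̂ (Perm.inverseˡ π)))
             (sym (trans (∣g∣↓≈P∣g∣ i) (permutationMatrix-*ᵥ P π P≈ ∣ g ∣ i)))) ⟩
      ε * M
        ∎

mainTheorem6 :
  ∀ {c ℓ₁ ℓ₂} (ℝ : RealNumbers c ℓ₁ ℓ₂) →
  let open RealNumbers ℝ
      open OWL ℝ
  in
  ∀ (n : ℕ) (w : Vec n) (ε : Carrier) (g : Vec n) →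
  w ∈ MonotoneNonNegative →
  ¬ (Pointwise _≈_ w 𝟎) →
  0# < ε →
  ∀ (P : Matrix n n) → IsSortingMatrix P ∣ g ∣ →
  ∀ (b̂ : Vec n) → b̂ ∈ ArgMax (𝓑 w) (λ x → x · (∣ g ∣ ↓)) →
  (ε • (sign g ⊙ (transpose P *ᵥ b̂))) ∈ ArgMax (λ s → Ω w s ≤ ε) (λ s → s · g)
mainTheorem6 = OWL-maximizer
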